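{- Let $n\ge 2$ be an integer. Then the number of couples $(u,v)$ of snakeshapes of size $n$ such that $\mathcal N_{u,v}=0$ is the $(n-2)$-th Fibonacci number, i.e. the number of snakeshapes of size $n-2$.
   Context: A snakeshape of size $n$ is a word $u=u_1u_2\cdots u_k$ with letters in $\{1,2\}$ and $u_1+\cdots+u_k=n$ (the empty word $\emptyset$ for $n=0$); its length is $\ell(u)=k$. It is drawn as $k$ bottom-justified columns, read from left to right, the $i$-th column having $u_i$ boxes. In a single-boxed column the unique box is both bottom and top box. The $m$-th Fibonacci number is the number of snakeshapes of size $m$ (compositions of $m$ with parts equal to $1$ or $2$), so the $0$-th and the first are both equal to $1$. A semi-standard Young-Fibonacci tableau is a numbering of the boxes of a snakeshape with nonnegative integers, not necessarily distinct, such that: (1) in each two-boxed column the top entry is strictly larger than the bottom entry; (2) the entry in the top box of any column (in particular the entry of any single-boxed column) has no entry strictly greater than itself in the columns to its right. For two snakeshapes $u,v$ of size $n$, the Young-Fibonacci number $\mathcal N_{u,v}$ is the number of distinct semi-standard Young-Fibonacci tableaux of shape $u$ and valuation $v$, that is, having exactly $v_i$ entries equal to $i$ for $i=1,\dots,\ell(v)$. -}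

module Defs where

open import Data.Bool using (true; false)
open import Data.Fin using (Fin; zero; suc; toℕ)
import Data.Fin.Properties as Fin
open import Data.List using
  (List; []; _∷_; _++_; map; filter; length; lookup; upTo; cartesianProductWith)
open import Data.List.Membership.Propositional using (_∈_)
open import Data.List.Membership.Propositional.Properties using
  (∈-map⁺; ∈-map⁻; ∈-++⁺ˡ; ∈-++⁺ʳ; ∈-++⁻; ∈-upTo⁺; ∈-filter⁺; ∈-filter⁻; ∈-cartesianProductWith⁺)
open import Data.List.Properties using (filter-accept; filter-reject)
open import Data.List.Relation.Unary.All as All using (All; []; _∷_)
open import Data.List.Relation.Unary.All.Properties using (++⁻)
open import Data.List.Relation.Unary.AllPairs using ([]; _∷_)
open import Data.List.Relation.Unary.Any using (here; there)
open import Data.List.Relation.Unary.Unique.Propositional using (Unique)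
import Data.List.Relation.Unary.Unique.Propositional.Properties as Unique
open import Data.Nat using (ℕ; zero; suc; _+_; _≤_; _<_; z≤n; s≤s; _≟_; _≤?_; _<?_)
open import Data.Nat.ListAction using (sum)
open import Data.Nat.Properties using
  (+-suc; +-identityʳ; +-cancelˡ-≡; ≤-reflexive; m≤m+n; suc-injective; m+1+n≢m)
open import Data.Product using (_×_; _,_; proj₁; proj₂)
open import Data.Sum using (inj₁; inj₂)
open import Data.Unit using (⊤; tt)
open import Function using (_∘_)
open import Relation.Binary.PropositionalEquality using
  (_≡_; _≢_; refl; sym; trans; cong; subst)
open import Relation.Nullary using (Dec; yes; no; does; ¬_; ¬?)
open import Relation.Nullary.Decidable using (_×-dec_)
open import Relation.Unary using (Decidable)

------------------------------------------------------------------------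
-- Snakeshapes

data Letter : Set where
  𝟙 𝟚 : Letter

value : Letter → ℕ
value 𝟙 = 1
value 𝟚 = 2

Snakeshape : Set
Snakeshape = List Letter

size : Snakeshape → ℕ
size u = sum (map value u)

-- The snakeshapes of size n, each listed exactly once (see
-- ∈-snakeshapes⁺, ∈-snakeshapes⁻ and snakeshapes-unique below).
snakeshapes : ℕ → List Snakeshape
snakeshapes zero          = [] ∷ []
snakeshapes (suc zero)    = (𝟙 ∷ []) ∷ []
snakeshapes (suc (suc n)) =
  map (𝟙 ∷_) (snakeshapes (suc n)) ++ map (𝟚 ∷_) (snakeshapes n)

fibonacci : ℕ → ℕ
fibonacci m = length (snakeshapes m)

------------------------------------------------------------------------
-- Semi-standard Young-Fibonacci tableaux

data Column : Letter → Set where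
  single : (entry : ℕ) → Column 𝟙
  double : (bottom top : ℕ) → Column 𝟚

topEntry : ∀ {a} → Column a → ℕ
topEntry (single e)   = e
topEntry (double _ t) = t

columnEntries : ∀ {a} → Column a → List ℕ
columnEntries (single e)   = e ∷ []
columnEntries (double b t) = b ∷ t ∷ []

-- A numbering of the boxes of u: one filled column per letter of u,
-- from left to right.
Numbering : Snakeshape → Set
Numbering u = All Column u

entries : ∀ {u} → Numbering u → List ℕ
entries []      = []
entries (c ∷ t) = columnEntries c ++ entries t

StrictColumn : ∀ {a} → Column a → Set
StrictColumn (single _)   = ⊤
StrictColumn (double b t) = b < t

SemiStandard : ∀ {u} → Numbering u → Set
SemiStandard []      = ⊤
SemiStandard (c ∷ t) =
  StrictColumn c × All (_≤ topEntry c) (entries t) × SemiStandard t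

occurrences : ℕ → List ℕ → ℕ
occurrences i xs = length (filter (_≟ i) xs)

-- Positions in v are numbered from 0 by Fin, hence the shift by one.
HasValuation : Snakeshape → ∀ {u} → Numbering u → Set
HasValuation v t =
  (i : Fin (length v)) → occurrences (suc (toℕ i)) (entries t) ≡ value (lookup v i)

IsTableau : (u v : Snakeshape) → Numbering u → Set
IsTableau u v t = SemiStandard t × HasValuation v t

strictColumn? : ∀ {a} (c : Column a) → Dec (StrictColumn c)
strictColumn? (single _)   = yes tt
strictColumn? (double b t) = b <? t

semiStandard? : ∀ {u} → Decidable (SemiStandard {u})
semiStandard? []      = yes tt
semiStandard? (c ∷ t) =
  strictColumn? c ×-dec All.all? (_≤? topEntry c) (entries t) ×-dec semiStandard? t

hasValuation? : ∀ v {u} → Decidable (HasValuation v {u})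
hasValuation? v t =
  Fin.all? λ i → occurrences (suc (toℕ i)) (entries t) ≟ value (lookup v i)

isTableau? : ∀ u v → Decidable (IsTableau u v)
isTableau? u v t = semiStandard? t ×-dec hasValuation? v t

-- Columns and numberings all of whose entries are at most m.
columns : ℕ → (a : Letter) → List (Column a)
columns m 𝟙 = map single (upTo (suc m))
columns m 𝟚 = cartesianProductWith double (upTo (suc m)) (upTo (suc m))

numberings : ℕ → (u : Snakeshape) → List (Numbering u)
numberings m []      = [] ∷ []
numberings m (a ∷ u) = cartesianProductWith _∷_ (columns m a) (numberings m u)

-- When size u ≡ size v, a valuation v forces every entry to lie between
-- 1 and ℓ(v), so bounding the entries by ℓ(v) loses no tableau: tableaux
-- lists every tableau of shape u and valuation v, exactly once (see
-- ∈-tableaux⁺, ∈-tableaux⁻ and tableaux-unique below).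
tableaux : (u v : Snakeshape) → List (Numbering u)
tableaux u v = filter (isTableau? u v) (numberings (length v) u)

-- The Young-Fibonacci number; meaningful for size u ≡ size v only.
𝒩 : Snakeshape → Snakeshape → ℕ
𝒩 u v = length (tableaux u v)

------------------------------------------------------------------------
-- Correctness of the enumeration of snakeshapes

∈-snakeshapes⁺ : ∀ {u n} → size u ≡ n → u ∈ snakeshapes n
∈-snakeshapes⁺ {u} refl = complete u
  where
  complete : ∀ u → u ∈ snakeshapes (size u)
  step : ∀ u n → u ∈ snakeshapes n → (𝟙 ∷ u) ∈ snakeshapes (suc n)
  complete []      = here refl
  complete (𝟙 ∷ u) = step u (size u) (complete u)
  complete (𝟚 ∷ u) =
    ∈-++⁺ʳ (map (𝟙 ∷_) (snakeshapes (suc (size u)))) (∈-map⁺ (𝟚 ∷_) (complete u))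
  step u zero    (here refl) = here refl
  step u (suc n) u∈          = ∈-++⁺ˡ (∈-map⁺ (𝟙 ∷_) u∈)

∈-snakeshapes⁻ : ∀ n {u} → u ∈ snakeshapes n → size u ≡ n
∈-snakeshapes⁻ zero          (here refl) = refl
∈-snakeshapes⁻ (suc zero)    (here refl) = refl
∈-snakeshapes⁻ (suc (suc n)) u∈ with ∈-++⁻ (map (𝟙 ∷_) (snakeshapes (suc n))) u∈
... | inj₁ p with _ , w∈ , refl ← ∈-map⁻ (𝟙 ∷_) p = cong suc (∈-snakeshapes⁻ (suc n) w∈)
... | inj₂ p with _ , w∈ , refl ← ∈-map⁻ (𝟚 ∷_) p = cong (2 +_) (∈-snakeshapes⁻ n w∈)

snakeshapes-unique : ∀ n → Unique (snakeshapes n)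
snakeshapes-unique zero          = [] ∷ []
snakeshapes-unique (suc zero)    = [] ∷ []
snakeshapes-unique (suc (suc n)) =
  Unique.++⁺ (Unique.map⁺ (λ { refl → refl }) (snakeshapes-unique (suc n)))
             (Unique.map⁺ (λ { refl → refl }) (snakeshapes-unique n))
             disjoint
  where
  disjoint : ∀ {u} → ¬ (u ∈ map (𝟙 ∷_) (snakeshapes (suc n)) × u ∈ map (𝟚 ∷_) (snakeshapes n))
  disjoint (p , q) with ∈-map⁻ (𝟙 ∷_) p | ∈-map⁻ (𝟚 ∷_) q
  ... | _ , _ , refl | _ , _ , ()

------------------------------------------------------------------------
-- Correctness of the enumeration of tableaux

length-entries : ∀ {u} (t : Numbering u) → length (entries t) ≡ size u
length-entries []               = refl
length-entries (single _ ∷ t)   = cong suc (length-entries t)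
length-entries (double _ _ ∷ t) = cong (2 +_) (length-entries t)

private
  remove : ℕ → List ℕ → List ℕ
  remove i = filter (λ x → ¬? (x ≟ i))

  length-remove : ∀ i xs → length xs ≡ occurrences i xs + length (remove i xs)
  length-remove i []       = refl
  length-remove i (x ∷ xs) with does (x ≟ i)
  ... | true  = cong suc (length-remove i xs)
  ... | false = trans (cong suc (length-remove i xs)) (sym (+-suc (occurrences i xs) _))

  occurrences-remove : ∀ {i j} → j ≢ i → ∀ xs → occurrences j (remove i xs) ≡ occurrences j xs
  occurrences-remove         j≢i []       = refl
  occurrences-remove {i} {j} j≢i (x ∷ xs) = split (x ≟ i)
    where
    split : Dec (x ≡ i) → occurrences j (remove i (x ∷ xs)) ≡ occurrences j (x ∷ xs)
    split (yes refl)
      rewrite filter-reject (λ y → ¬? (y ≟ i)) {x} {xs} (λ x≢x → x≢x refl)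
            | filter-reject (_≟ j) {x} {xs} (j≢i ∘ sym) = occurrences-remove j≢i xs
    split (no x≢i)
      rewrite filter-accept (λ y → ¬? (y ≟ i)) {x} {xs} x≢i with does (x ≟ j)
    ... | true  = cong suc (occurrences-remove j≢i xs)
    ... | false = occurrences-remove j≢i xs

  InRange : ℕ → ℕ → ℕ → Set
  InRange o k x = o < x × x ≤ o + k

  inRange : ∀ o v xs → length xs ≡ size v →
            (∀ i → occurrences (suc (o + toℕ i)) xs ≡ value (lookup v i)) →
            All (InRange o (length v)) xs
  inRange o []      []  _  _   = []
  inRange o (a ∷ v) xs len occ = All.tabulate λ {x} → bound x
    where
    first : occurrences (suc o) xs ≡ value a
    first = subst (λ m → occurrences (suc m) xs ≡ value a) (+-identityʳ o) (occ zero)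

    rest : All (InRange (suc o) (length v)) (remove (suc o) xs)
    rest = inRange (suc o) v (remove (suc o) xs)
      (+-cancelˡ-≡ (value a) _ _
        (trans (cong (_+ length (remove (suc o) xs)) (sym first))
               (trans (sym (length-remove (suc o) xs)) len)))
      (λ i → trans (occurrences-remove (λ eq → m+1+n≢m o
                      (trans (+-suc o (toℕ i)) (suc-injective eq))) xs)
                   (subst (λ m → occurrences (suc m) xs ≡ value (lookup v i))
                          (+-suc o (toℕ i)) (occ (suc i))))

    bound : ∀ x → x ∈ xs → InRange o (suc (length v)) x
    bound x x∈ with x ≟ suc o
    ... | yes refl = ≤-reflexive refl
                   , subst (suc o ≤_) (sym (+-suc o (length v))) (s≤s (m≤m+n o (length v)))
    ... | no  x≢ with o<x , x≤ ← All.lookup rest (∈-filter⁺ (λ x → ¬? (x ≟ suc o)) x∈ x≢)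
                   = <-weaken o<x , subst (x ≤_) (sym (+-suc o (length v))) x≤
      where
      <-weaken : ∀ {m n} → suc m < n → m < n
      <-weaken {zero}  (s≤s _) = s≤s z≤n
      <-weaken {suc m} (s≤s p) = s≤s (<-weaken p)

entries-inRange : ∀ {u v} (t : Numbering u) → size u ≡ size v → HasValuation v t →
                  All (λ x → 1 ≤ x × x ≤ length v) (entries t)
entries-inRange {v = v} t eq val = inRange 0 v (entries t) (trans (length-entries t) eq) val

∈-numberings⁺ : ∀ m {u} (t : Numbering u) → All (_≤ m) (entries t) → t ∈ numberings m u
∈-numberings⁺ m []      _  = here refl
∈-numberings⁺ m (c ∷ t) ≤m with ++⁻ (columnEntries c) ≤m
... | c≤m , t≤m = ∈-cartesianProductWith⁺ _∷_ (column c c≤m) (∈-numberings⁺ m t t≤m)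
  where
  column : ∀ {a} (c : Column a) → All (_≤ m) (columnEntries c) → c ∈ columns m a
  column (single e)   (e≤m ∷ [])       = ∈-map⁺ single (∈-upTo⁺ (s≤s e≤m))
  column (double b t) (b≤m ∷ t≤m ∷ []) =
    ∈-cartesianProductWith⁺ double (∈-upTo⁺ (s≤s b≤m)) (∈-upTo⁺ (s≤s t≤m))

numberings-unique : ∀ m u → Unique (numberings m u)
numberings-unique m []      = [] ∷ []
numberings-unique m (a ∷ u) =
  Unique.cartesianProductWith⁺ _∷_ (λ eq → cong All.head eq , cong All.tail eq)
    (columns-unique a) (numberings-unique m u)
  where
  columns-unique : ∀ a → Unique (columns m a)
  columns-unique 𝟙 = Unique.map⁺ (λ { refl → refl }) (Unique.upTo⁺ (suc m))
  columns-unique 𝟚 = Unique.cartesianProductWith⁺ double (λ { refl → refl , refl })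
                       (Unique.upTo⁺ (suc m)) (Unique.upTo⁺ (suc m))

∈-tableaux⁺ : ∀ u v {t : Numbering u} → size u ≡ size v → IsTableau u v t → t ∈ tableaux u v
∈-tableaux⁺ u v {t} eq tab =
  ∈-filter⁺ (isTableau? u v)
    (∈-numberings⁺ (length v) t (All.map proj₂ (entries-inRange {v = v} t eq (proj₂ tab)))) tab

∈-tableaux⁻ : ∀ u v {t : Numbering u} → t ∈ tableaux u v → IsTableau u v t
∈-tableaux⁻ u v = proj₂ ∘ ∈-filter⁻ (isTableau? u v) {xs = numberings (length v) u}

tableaux-unique : ∀ u v → Unique (tableaux u v)
tableaux-unique u v = Unique.filter⁺ (isTableau? u v) (numberings-unique (length v) u)

{-# OPTIONS --safe #-}

-- 𝒩 u v vanishes exactly when u = 1ⁿ⁻²2 and v begins with 2.  For such u every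
-- entry but the bottom of the last column exceeds that bottom, so two entries
-- equal to 1 are impossible.  For all other pairs, fill u from left to right,
-- always using the largest remaining entry as top (or single) entry.  If the
-- smallest entry occurs once, the next smaller value is used as bottom entry,
-- which never leaves two equal smallest entries.  If the smallest entry occurs
-- twice, one copy goes to the bottom of the first double column, which reduces
-- the rest to the previous case.

module Submission where

open import Defs
open import Data.Bool using (true; false)
open import Data.Empty using (⊥-elim)
open import Data.Fin using (zero; suc; toℕ)
open import Data.List using
  (List; []; _∷_; _++_; map; length; filter; cartesianProduct; lookup; replicate)
open import Data.List.Membership.Propositional using (_∈_)
open import Data.List.Membership.Propositional.Properties using
  (∈-map⁺; ∈-map⁻; ∈-filter⁺; ∈-filter⁻; ∈-cartesianProduct⁺; ∈-cartesianProduct⁻)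
open import Data.List.Membership.Propositional.Properties.WithK using (unique∧set⇒bag)
open import Data.List.Properties using (filter-accept; filter-reject; length-map)
open import Data.List.Relation.Binary.BagAndSetEquality using (∼bag⇒↭)
open import Data.List.Relation.Binary.Permutation.Propositional using
  (_↭_; refl; prep; swap; ↭-trans; ↭-sym)
open import Data.List.Relation.Binary.Permutation.Propositional.Properties using
  (All-resp-↭; ↭-length; filter-↭)
open import Data.List.Relation.Unary.All as All using (All; []; _∷_)
open import Data.List.Relation.Unary.Any using (Any; here; there)
import Data.List.Relation.Unary.Unique.Propositional.Properties as Unique
open import Data.Nat using (ℕ; zero; suc; _+_; _≤_; _<_; _∸_; _≟_; z≤n; s≤s)
open import Data.Nat.Properties using
  (≤-refl; ≤-trans; ≤-reflexive; <⇒≤; <-trans; <-≤-trans; ≤-<-trans; n≤1+n; >⇒≢; <⇒≢;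
   +-suc; +-identityʳ; suc-injective; 1+n≰n)
open import Data.Product using (∃; _×_; _,_; proj₁)
open import Data.Sum using (_⊎_; inj₁; inj₂)
import Data.Sum as Sum
open import Function.Bundles using (mk⇔)
open import Relation.Binary.PropositionalEquality using
  (_≡_; _≢_; refl; sym; trans; cong; subst)
open import Relation.Nullary using (¬_; does)

private
  variable
    a       : Letter
    u       : Snakeshape
    x y i o : ℕ
    xs ys   : List ℕ

-- Descending lists.

-- Weakly decreasing lists without three equal entries; the index tells
-- whether the smallest entry occurs once or twice.
data Descending : Letter → List ℕ → Set where
  []   : Descending 𝟙 []
  one  : Descending 𝟙 (x ∷ [])
  two  : Descending 𝟚 (x ∷ x ∷ [])
  step : y < x → Descending a (y ∷ xs) → Descending a (x ∷ y ∷ xs)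
  twin : y < x → Descending a (y ∷ xs) → Descending a (x ∷ x ∷ y ∷ xs)

descending⇒head-max : Descending a (x ∷ xs) → All (_≤ x) xs
descending⇒head-max one          = []
descending⇒head-max two          = ≤-refl ∷ []
descending⇒head-max (step y<x d) =
  <⇒≤ y<x ∷ All.map (λ z≤y → ≤-trans z≤y (<⇒≤ y<x)) (descending⇒head-max d)
descending⇒head-max (twin y<x d) = ≤-refl ∷ descending⇒head-max (step y<x d)

descending-tail : Descending 𝟙 (x ∷ xs) → Descending 𝟙 xs
descending-tail one          = []
descending-tail (step _ d)   = d
descending-tail (twin y<x d) = step y<x d

-- Index `𝟙` is essential: raising the head of a `two` list would leave its minimum occurring only
-- once.
descending-raise : x < y → Descending 𝟙 (x ∷ xs) → Descending 𝟙 (y ∷ xs)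
descending-raise _   one          = one
descending-raise x<y (step z<x d) = step (<-trans z<x x<y) d
descending-raise x<y (twin z<x d) = step x<y (step z<x d)

-- The head survives even for `two`, where its other copy is removed. Keeping it in the result lets
-- the recursion put `step` or `twin` back on top.
descending-remove-min : Descending 𝟚 (x ∷ xs) →
                        ∃ λ m → ∃ λ ys → xs ↭ m ∷ ys × Descending 𝟙 (x ∷ ys)
descending-remove-min two = _ , _ , refl , one
descending-remove-min (step y<x d) with m , ys , p , d′ ← descending-remove-min d =
  m , _ ∷ ys , ↭-trans (prep _ p) (swap _ _ refl) , step y<x d′
descending-remove-min (twin y<x d) with m , ys , p , d′ ← descending-remove-min d =
  m , _ ∷ _ ∷ ys
  , ↭-trans (prep _ (↭-trans (prep _ p) (swap _ _ refl))) (swap _ _ refl)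
  , twin y<x d′

-- Filling a shape from a descending list.

-- Permutations suffice, as a valuation sees only the multiset of entries; they are necessary, as
-- `entries` reads bottom before top.
Fillable : List ℕ → Snakeshape → Set
Fillable xs u = ∃ λ (t : Numbering u) → SemiStandard t × entries t ↭ xs

fillable-single : All (_≤ x) xs → Fillable xs u → Fillable (x ∷ xs) (𝟙 ∷ u)
fillable-single xs≤x (t , ss , p) =
  single _ ∷ t , (_ , All-resp-↭ (↭-sym p) xs≤x , ss) , prep _ p

fillable-double : y < x → xs ↭ y ∷ ys → All (_≤ x) xs → Fillable ys u →
                  Fillable (x ∷ xs) (𝟚 ∷ u)
fillable-double y<x q xs≤x (t , ss , p) =
  double _ _ ∷ t
  , (y<x , All-resp-↭ (↭-sym p) (All.tail (All-resp-↭ q xs≤x)) , ss)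
  , ↭-trans (swap _ _ p) (prep _ (↭-sym q))

descending-𝟙⇒fillable : Descending 𝟙 xs → ∀ u → length xs ≡ size u → Fillable xs u
descending-𝟙⇒fillable []             []      _  = [] , _ , refl
descending-𝟙⇒fillable []             (𝟙 ∷ _) ()
descending-𝟙⇒fillable []             (𝟚 ∷ _) ()
descending-𝟙⇒fillable {_ ∷ _} d      (𝟙 ∷ u) eq =
  fillable-single (descending⇒head-max d)
    (descending-𝟙⇒fillable (descending-tail d) u (suc-injective eq))
descending-𝟙⇒fillable d@(step y<x d′) (𝟚 ∷ u) eq =
  fillable-double y<x refl (descending⇒head-max d)
    (descending-𝟙⇒fillable (descending-tail d′) u (suc-injective (suc-injective eq)))
-- The second copy of the top entry takes the place of `y` at the head of the remaining list.
descending-𝟙⇒fillable d@(twin y<x d′) (𝟚 ∷ u) eq =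
  fillable-double y<x (swap _ _ refl) (descending⇒head-max d)
    (descending-𝟙⇒fillable (descending-raise y<x d′) u (suc-injective (suc-injective eq)))

hook : ℕ → Snakeshape
hook zero    = 𝟚 ∷ []
hook (suc k) = 𝟙 ∷ hook k

-- Single columns preserve index `𝟚` until just two equal entries remain. The second alternative
-- arises only if these face a lone double column; the single columns passed on the way extend it to
-- a longer hook.
descending-𝟚⇒fillable : Descending 𝟚 xs → ∀ u → length xs ≡ size u →
                        Fillable xs u ⊎ ∃ λ k → u ≡ hook k
descending-𝟚⇒fillable two (𝟙 ∷ u) eq =
  inj₁ (fillable-single (≤-refl ∷ []) (descending-𝟙⇒fillable one u (suc-injective eq)))
descending-𝟚⇒fillable two (𝟚 ∷ [])    _ = inj₂ (zero , refl)
descending-𝟚⇒fillable two (𝟚 ∷ 𝟙 ∷ _) ()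
descending-𝟚⇒fillable two (𝟚 ∷ 𝟚 ∷ _) ()
descending-𝟚⇒fillable d@(step _ d′) (𝟙 ∷ u) eq =
  Sum.map (fillable-single (descending⇒head-max d)) (λ { (k , refl) → suc k , refl })
    (descending-𝟚⇒fillable d′ u (suc-injective eq))
descending-𝟚⇒fillable d@(twin y<x d′) (𝟙 ∷ u) eq =
  Sum.map (fillable-single (descending⇒head-max d)) (λ { (k , refl) → suc k , refl })
    (descending-𝟚⇒fillable (step y<x d′) u (suc-injective eq))
descending-𝟚⇒fillable d@(step y<x d′) (𝟚 ∷ u) eq
  with m , ys , p , e ← descending-remove-min d′ =
  -- The removed minimum `m` is at most `y`, hence strictly below the top entry.
  inj₁ (fillable-double (≤-<-trans (All.head (All-resp-↭ p (descending⇒head-max d′))) y<x)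
    (↭-trans (prep _ p) (swap _ _ refl)) (descending⇒head-max d)
    (descending-𝟙⇒fillable e u
      (trans (sym (↭-length p)) (suc-injective (suc-injective eq)))))
descending-𝟚⇒fillable d@(twin y<x d′) (𝟚 ∷ u) eq
  with m , ys , p , e ← descending-remove-min d′ =
  inj₁ (fillable-double (≤-<-trans (All.head (All-resp-↭ p (descending⇒head-max d′))) y<x)
    (↭-trans (prep _ (↭-trans (prep _ p) (swap _ _ refl))) (swap _ _ refl))
    (descending⇒head-max d)
    -- With `m` as bottom, both the spare maximum and `y` stay in the list.
    (descending-𝟙⇒fillable (step y<x e) u
      (trans (sym (cong suc (↭-length p))) (suc-injective (suc-injective eq)))))

-- The entries prescribed by a valuation.

-- The entries prescribed by v, shifted by o, in decreasing order in front of acc.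
content : ℕ → Snakeshape → List ℕ → List ℕ
content o []      acc = acc
content o (a ∷ v) acc = content (suc o) v (replicate (value a) (suc o) ++ acc)

content-length : ∀ o v acc → length (content o v acc) ≡ size v + length acc
content-length o []      acc = refl
content-length o (𝟙 ∷ v) acc = trans (content-length (suc o) v _) (+-suc (size v) _)
content-length o (𝟚 ∷ v) acc =
  trans (content-length (suc o) v _)
    (trans (+-suc (size v) _) (cong suc (+-suc (size v) _)))

-- Each letter puts a strictly larger value in front, so the multiplicity of the smallest entry,
-- recorded by the index, never changes.
content-descending : ∀ v → x ≤ o → Descending a (x ∷ xs) → Descending a (content o v (x ∷ xs))
content-descending []      _   d = d
content-descending (𝟙 ∷ v) x≤o d = content-descending v ≤-refl (step (s≤s x≤o) d)
content-descending (𝟚 ∷ v) x≤o d = content-descending v ≤-refl (twin (s≤s x≤o) d)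

occurrences-replicate-≡ : ∀ k i xs → occurrences i (replicate k i ++ xs) ≡ k + occurrences i xs
occurrences-replicate-≡ zero    i xs = refl
occurrences-replicate-≡ (suc k) i xs =
  trans (cong length (filter-accept (_≟ i) {xs = replicate k i ++ xs} refl))
        (cong suc (occurrences-replicate-≡ k i xs))

occurrences-replicate-≢ : ∀ k xs → x ≢ i → occurrences i (replicate k x ++ xs) ≡ occurrences i xs
occurrences-replicate-≢         zero    xs x≢i = refl
occurrences-replicate-≢ {x} {i} (suc k) xs x≢i =
  trans (cong length (filter-reject (_≟ i) {xs = replicate k x ++ xs} x≢i))
        (occurrences-replicate-≢ k xs x≢i)

content-occurrences-≤ : ∀ v acc → i ≤ o → occurrences i (content o v acc) ≡ occurrences i acc
content-occurrences-≤ []      acc i≤o = refl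
content-occurrences-≤ (a ∷ v) acc i≤o =
  trans (content-occurrences-≤ v _ (≤-trans i≤o (n≤1+n _)))
        (occurrences-replicate-≢ (value a) acc (>⇒≢ (s≤s i≤o)))

-- The hypothesis on `acc` makes the copies of `suc o` just added the only ones; later letters add
-- larger values only.
content-occurrences : ∀ o v acc → (∀ j → o < j → occurrences j acc ≡ 0) → ∀ i →
  occurrences (suc (o + toℕ i)) (content o v acc) ≡ value (lookup v i)
content-occurrences o (a ∷ v) acc none zero rewrite +-identityʳ o =
  trans (content-occurrences-≤ v _ ≤-refl)
    (trans (occurrences-replicate-≡ (value a) (suc o) acc)
      (trans (cong (value a +_) (none (suc o) ≤-refl)) (+-identityʳ (value a))))
content-occurrences o (a ∷ v) acc none (suc i) rewrite +-suc o (toℕ i) =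
  content-occurrences (suc o) v _
    (λ j o<j → trans (occurrences-replicate-≢ (value a) acc (<⇒≢ o<j)) (none j (<⇒≤ o<j))) i

fillable⇒tableau : ∀ u v → Fillable (content 0 v []) u → ∃ (IsTableau u v)
fillable⇒tableau u v (t , ss , p) = t , ss , λ i →
  trans (↭-length (filter-↭ (_≟ suc (toℕ i)) p))
        (content-occurrences 0 v [] (λ _ _ → refl) i)

-- The smallest prescribed entry is 1, with multiplicity `value b`, so `b` is the index of the
-- descending content.
tableau⊎hook : ∀ u b v → size u ≡ size (b ∷ v) →
               ∃ (IsTableau u (b ∷ v)) ⊎ (b ≡ 𝟚 × ∃ λ k → u ≡ hook k)
tableau⊎hook u 𝟙 v eq = inj₁ (fillable⇒tableau u (𝟙 ∷ v)
  (descending-𝟙⇒fillable (content-descending v ≤-refl one) u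
    (trans (content-length 0 (𝟙 ∷ v) []) (trans (+-identityʳ _) (sym eq)))))
tableau⊎hook u 𝟚 v eq = Sum.map (fillable⇒tableau u (𝟚 ∷ v)) (refl ,_)
  (descending-𝟚⇒fillable (content-descending v ≤-refl two) u
    (trans (content-length 0 (𝟚 ∷ v) []) (trans (+-identityʳ _) (sym eq))))

-- Hooks.

-- The second conjunct carries the induction: an entry above 1 further right forces each single
-- entry above 1. Positivity excludes a top 1 over a bottom 0.
hook-occurrences-1 : ∀ k (t : Numbering (hook k)) → SemiStandard t → All (1 ≤_) (entries t) →
                     occurrences 1 (entries t) ≤ 1 × Any (1 <_) (entries t)
hook-occurrences-1 zero (double b c ∷ []) (b<c , _) (1≤b ∷ _) =
  occ , there (here (≤-<-trans 1≤b b<c))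
  where
  c-reject : filter (_≟ 1) (c ∷ []) ≡ []
  c-reject = filter-reject (_≟ 1) (>⇒≢ (≤-<-trans 1≤b b<c))

  occ : occurrences 1 (b ∷ c ∷ []) ≤ 1
  occ with does (b ≟ 1)
  ... | true  = s≤s (≤-reflexive (cong length c-reject))
  ... | false = ≤-trans (≤-reflexive (cong length c-reject)) z≤n
hook-occurrences-1 (suc k) (single e ∷ t) (_ , ≤e , ss) (_ ∷ 1≤)
  with occ , any ← hook-occurrences-1 k t ss 1≤ =
  -- Here `e ∷ entries t` is read as `replicate 1 e ++ entries t`.
  subst (_≤ 1) (sym (occurrences-replicate-≢ 1 (entries t) (>⇒≢ 1<e))) occ , here 1<e
  where
  1<e : 1 < e
  1<e = All.lookupWith (λ x≤e 1<x → <-≤-trans 1<x x≤e) ≤e any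

hook-no-tableau : ∀ k v → size (hook k) ≡ size (𝟚 ∷ v) → ¬ ∃ (IsTableau (hook k) (𝟚 ∷ v))
-- Position `zero` of the valuation demands two entries equal to 1, so the bound becomes `2 ≤ 1`.
hook-no-tableau k v eq (t , ss , val) = 1+n≰n (subst (_≤ 1) (val zero)
  (proj₁ (hook-occurrences-1 k t ss (All.map proj₁ (entries-inRange {v = 𝟚 ∷ v} t eq val)))))

-- Counting the vanishing pairs.

𝒩≡0⇒no-tableau : ∀ u v → size u ≡ size v → 𝒩 u v ≡ 0 → ¬ ∃ (IsTableau u v)
𝒩≡0⇒no-tableau u v eq 𝒩≡0 (t , tab) with tableaux u v | ∈-tableaux⁺ u v eq tab
𝒩≡0⇒no-tableau u v eq () (t , tab) | _ ∷ _ | _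

no-tableau⇒𝒩≡0 : ∀ u v → ¬ ∃ (IsTableau u v) → 𝒩 u v ≡ 0
no-tableau⇒𝒩≡0 u v none with tableaux u v | ∈-tableaux⁻ u v
... | []    | _     = refl
... | t ∷ _ | sound = ⊥-elim (none (t , sound (here refl)))

size-hook : ∀ k → size (hook k) ≡ 2 + k
size-hook zero    = refl
size-hook (suc k) = cong suc (size-hook k)

Vanishing : ℕ → List (Snakeshape × Snakeshape)
Vanishing n = filter (λ (u , v) → 𝒩 u v ≟ 0) (cartesianProduct (snakeshapes n) (snakeshapes n))

-- With `v` ranging freely over size `n`, these are the exceptional pairs of size `2 + n`.
hookPair : ℕ → Snakeshape → Snakeshape × Snakeshape
hookPair n v = hook n , 𝟚 ∷ v

∈-vanishing⁺ : ∀ n {v} → size v ≡ n → hookPair n v ∈ Vanishing (2 + n)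
∈-vanishing⁺ n {v} eq = ∈-filter⁺ _
  (∈-cartesianProduct⁺ (∈-snakeshapes⁺ (size-hook n)) (∈-snakeshapes⁺ (cong (2 +_) eq)))
  (no-tableau⇒𝒩≡0 (hook n) (𝟚 ∷ v)
    (hook-no-tableau n v (trans (size-hook n) (sym (cong (2 +_) eq)))))

∈-vanishing⁻ : ∀ n {u v} → (u , v) ∈ Vanishing (2 + n) →
               ∃ λ v′ → size v′ ≡ n × (u , v) ≡ hookPair n v′
∈-vanishing⁻ n {u} {v} uv∈
  with uv∈′ , 𝒩≡0 ← ∈-filter⁻ (λ (u , v) → 𝒩 u v ≟ 0)
                       {xs = cartesianProduct (snakeshapes (2 + n)) (snakeshapes (2 + n))} uv∈
  with u∈ , v∈ ← ∈-cartesianProduct⁻ (snakeshapes (2 + n)) (snakeshapes (2 + n)) uv∈′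
  = go v (∈-snakeshapes⁻ (2 + n) u∈) (∈-snakeshapes⁻ (2 + n) v∈) 𝒩≡0
  where
  go : ∀ v → size u ≡ 2 + n → size v ≡ 2 + n → 𝒩 u v ≡ 0 →
       ∃ λ v′ → size v′ ≡ n × (u , v) ≡ hookPair n v′
  go (b ∷ v) |u| |v| 𝒩≡0 with tableau⊎hook u b v (trans |u| (sym |v|))
  ... | inj₁ tab = ⊥-elim (𝒩≡0⇒no-tableau u (b ∷ v) (trans |u| (sym |v|)) 𝒩≡0 tab)
  ... | inj₂ (refl , k , refl)
    -- Comparing sizes forces `k` to be `n`.
    with refl ← suc-injective (suc-injective (trans (sym (size-hook k)) |u|)) =
    v , suc-injective (suc-injective |v|) , refl

-- Duplicate-free lists with the same members are equal as bags, hence permutations of each other.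
vanishing-↭ : ∀ n → Vanishing (2 + n) ↭ map (hookPair n) (snakeshapes n)
vanishing-↭ n = ∼bag⇒↭ (unique∧set⇒bag
  (Unique.filter⁺ _ (Unique.cartesianProduct⁺ (snakeshapes-unique (2 + n)) (snakeshapes-unique (2 + n))))
  (Unique.map⁺ (λ { refl → refl }) (snakeshapes-unique n))
  (mk⇔ to from))
  where
  to : ∀ {uv} → uv ∈ Vanishing (2 + n) → uv ∈ map (hookPair n) (snakeshapes n)
  to uv∈ with _ , |v| , refl ← ∈-vanishing⁻ n uv∈ = ∈-map⁺ (hookPair n) (∈-snakeshapes⁺ |v|)

  from : ∀ {uv} → uv ∈ map (hookPair n) (snakeshapes n) → uv ∈ Vanishing (2 + n)
  from uv∈ with _ , v∈ , refl ← ∈-map⁻ (hookPair n) uv∈ = ∈-vanishing⁺ n (∈-snakeshapes⁻ n v∈)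

theorem4p4 : (n : ℕ) → 2 ≤ n →
    length (filter (λ (u , v) → 𝒩 u v ≟ 0) (cartesianProduct (snakeshapes n) (snakeshapes n)))
    ≡ fibonacci (n ∸ 2)
theorem4p4 (suc zero)    (s≤s ())
theorem4p4 (suc (suc n)) _ =
  trans (↭-length (vanishing-↭ n)) (length-map (hookPair n) (snakeshapes n))
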